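{- In base $3$, the successor graph $G_s$ does not contain an infinite path; that is, there is no infinite sequence of positive integers $a(1), a(2), a(3), \ldots$ such that $a(n+1)$ is the comma-successor of $a(n)$ in base $3$ for every $n \ge 1$.
   Context: Work in base $b = 3$. For a positive integer $n$, let $\delta(n)$ denote its leading (most significant, nonzero) base-$b$ digit. For positive integers $k, k'$, we say that $k'$ is a comma-child of $k$ (in base $b$) if $k' - k = d\cdot b + \delta(k')$, where $d = k \bmod b$ is the last base-$b$ digit of $k$. If $k$ has at least one comma-child, the comma-successor of $k$ is its smallest comma-child; otherwise $k$ has no comma-successor. The successor graph $G_s$ (in base $b$) is the directed graph whose nodes are the positive integers, with an edge from $i$ to $j$ exactly when $j$ is the comma-successor of $i$. Paths are directed paths. -}

module Defs where

open import Data.Digit using (fromDigits)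
open import Data.Fin using (toℕ; fromℕ<)
open import Data.Fin.Properties using (toℕ-fromℕ<)
open import Data.List using ([]; _∷_; _∷ʳ_)
open import Data.Nat using (ℕ; suc; _+_; _*_; _≤_; _<_; _<?_; _/_; _%_; NonTrivial; NonZero; >-nonZero; nonTrivial⇒nonZero; nonTrivial⇒n>1)
open import Data.Nat.DivMod using (m/n<m; m%n<n; m≡m%n+[m/n]*n; m≥n⇒m/n>0)
open import Data.Nat.Induction using (Acc; acc; <-wellFounded)
open import Data.Nat.Properties using (≮⇒≥; <-≤-trans; <-trans; n<1+n; +-identityʳ)
open import Data.Product using (Σ-syntax; ∃-syntax; _×_; _,_; proj₁)
open import Level using (_⊔_)
open import Relation.Binary.Core using (Rel)
open import Relation.Binary.PropositionalEquality using (_≡_; sym; trans; cong₂)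
open import Relation.Nullary using (yes; no)

ℕ⁺ : Set
ℕ⁺ = ∃[ n ] 0 < n

value : ℕ⁺ → ℕ
value = proj₁

module _ (b : ℕ) .{{_ : NonTrivial b}} where

  private instance
    b≢0 : NonZero b
    b≢0 = nonTrivial⇒nonZero b

  n/b<n : ∀ {n} → b ≤ n → n / b < n
  n/b<n {n} b≤n = m/n<m n b {{n≢0}} (nonTrivial⇒n>1 b)
    where
    n≢0 : NonZero n
    n≢0 = >-nonZero (<-≤-trans (<-trans (n<1+n 0) (nonTrivial⇒n>1 b)) b≤n)

  -- Drop the last digit until a single one remains.
  leadingDigitAcc : ∀ n → Acc _<_ n → ℕ
  leadingDigitAcc n (acc rs) with n <? b
  ... | yes _  = n
  ... | no n≮b = leadingDigitAcc (n / b) (rs (n/b<n (≮⇒≥ n≮b)))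

  leadingDigit : ℕ → ℕ
  leadingDigit n = leadingDigitAcc n (<-wellFounded n)

  -- An Expansion lists its least significant digit first, so the digit ℓ
  -- appended at the end is the most significant one.
  IsLeadingDigit : ℕ → ℕ → Set
  IsLeadingDigit n m =
    ∃[ ds ] ∃[ ℓ ] fromDigits {b} (ds ∷ʳ ℓ) ≡ n × toℕ ℓ ≡ m × 0 < m

  leadingDigitAcc-correct : ∀ n (a : Acc _<_ n) → 0 < n →
                            IsLeadingDigit n (leadingDigitAcc n a)
  leadingDigitAcc-correct n (acc rs) 0<n with n <? b
  ... | yes n<b =
    [] , fromℕ< n<b , trans (+-identityʳ _) (toℕ-fromℕ< n<b) , toℕ-fromℕ< n<b , 0<n
  ... | no n≮b
    with ds , ℓ , ds≡ , ℓ≡ , 0<m ←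
      leadingDigitAcc-correct (n / b) (rs (n/b<n (≮⇒≥ n≮b))) (m≥n⇒m/n>0 (≮⇒≥ n≮b)) =
    fromℕ< (m%n<n n b) ∷ ds , ℓ ,
    trans (cong₂ (λ d q → d + q * b) (toℕ-fromℕ< (m%n<n n b)) ds≡)
          (sym (m≡m%n+[m/n]*n n b)) ,
    ℓ≡ , 0<m

  leadingDigit-correct : ∀ {n} → 0 < n → IsLeadingDigit n (leadingDigit n)
  leadingDigit-correct {n} = leadingDigitAcc-correct n (<-wellFounded n)

  -- k′ is a comma-child of k; the defining equation
  -- k′ - k = d * b + δ(k′) is written without subtraction.
  CommaChild : Rel ℕ⁺ _
  CommaChild k k′ =
    value k′ ≡ value k + (value k % b * b + leadingDigit (value k′))

  -- The edge relation of the successor graph: k′ is the comma-successor of k.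
  CommaSuccessor : Rel ℕ⁺ _
  CommaSuccessor k k′ =
    CommaChild k k′ × (∀ j → CommaChild k j → value k′ ≤ value j)

-- A directed graph is given by its edge relation.
InfinitePath : ∀ {v e} {V : Set v} → Rel V e → Set (v ⊔ e)
InfinitePath {V = V} _⟶_ = Σ[ a ∈ (ℕ → V) ] (∀ n → a n ⟶ a (suc n))

{-# OPTIONS --safe #-}
module Submission where

-- While the leading digit ℓ does not change, k steps to k + 3 (k mod 3) + ℓ,
-- and three such steps add 9 + 3 ℓ, that is 12 or 15, whatever k is. Hence how
-- a path crosses the block [3 ^ m , 3 ^ (m + 1)) depends only on 3 ^ m modulo
-- 60 and on the offset from 3 ^ m at which it enters the block, which is less
-- than 8. For m ≥ 1 the residues of 3 ^ m cycle through 21, 3, 9, 27. From a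
-- block with residue 21, each of the eight offsets leads within four blocks to
-- a number of the form 3 ^ j - 5, which has no comma-child.

open import Data.Nat
open import Defs
open import Relation.Nullary using (¬_)

open import Data.Empty using (⊥)
open import Data.Fin.Properties using (toℕ<n)
open import Data.Nat.Divisibility using (_∣_; divides; m∣m*n; ∣n⇒∣m*n)
open import Data.Nat.DivMod using (m*n/n≡m; +-distrib-/-∣ˡ; m<n*o⇒m/o<n; m%n<n; %-remove-+ˡ)
open import Data.Nat.GeneralisedArithmetic using (fold; fold-+)
open import Data.Nat.Induction using (Acc; acc; <-wellFounded)
open import Data.Nat.Properties
open import Data.Nat.Tactic.RingSolver using (solve-∀)
open import Data.Product using (∃-syntax; _×_; _,_; proj₁; proj₂)
open import Relation.Binary.PropositionalEquality
  using (_≡_; refl; sym; trans; cong; subst; module ≡-Reasoning)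
open import Relation.Nullary using (yes; no; contradiction)
open import Relation.Nullary.Decidable using (True; toWitness)

-- Leading digits in base 3.

data Digit⁺ : ℕ → Set where
  one : Digit⁺ 1
  two : Digit⁺ 2

digit⁺ : ∀ {d} → 0 < d → d < 3 → Digit⁺ d
digit⁺ {1} _ _ = one
digit⁺ {2} _ _ = two
digit⁺ {suc (suc (suc _))} _ (s≤s (s≤s (s≤s ())))

leadingDigit-digit⁺ : ∀ {n} → 0 < n → Digit⁺ (leadingDigit 3 n)
leadingDigit-digit⁺ 0<n with _ , ℓ , _ , ℓ≡ , 0<m ← leadingDigit-correct 3 0<n =
  digit⁺ 0<m (subst (_< 3) ℓ≡ (toℕ<n ℓ))

leadingDigit-^ : ∀ m {ℓ x} → Digit⁺ ℓ → x < 3 ^ m → leadingDigit 3 (ℓ * 3 ^ m + x) ≡ ℓ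
leadingDigit-^ m d x<3^m = go m d x<3^m refl (<-wellFounded _)
  where
  -- Both `n` and its accessibility proof are generalised, because the recursion reaches `n / 3`
  -- with an accessibility proof of its own.
  go : ∀ m {ℓ x n} → Digit⁺ ℓ → x < 3 ^ m → n ≡ ℓ * 3 ^ m + x →
       (a : Acc _<_ n) → leadingDigitAcc 3 n a ≡ ℓ
  go zero one z<s refl (acc _) = refl
  go zero two z<s refl (acc _) = refl
  go (suc m) {ℓ} {x} {n} d x< n≡ (acc rs) with n <? 3
  ... | no n≮3 = go m d (m<n*o⇒m/o<n (subst (x <_) (*-comm 3 (3 ^ m)) x<)) n/3≡
                    (rs (n/b<n 3 (≮⇒≥ n≮3)))
    where
    open ≡-Reasoning
    n/3≡ : n / 3 ≡ ℓ * 3 ^ m + x / 3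
    n/3≡ = begin
      n / 3                           ≡⟨ cong (_/ 3) n≡ ⟩
      (ℓ * (3 * 3 ^ m) + x) / 3       ≡⟨ +-distrib-/-∣ˡ x (∣n⇒∣m*n ℓ (m∣m*n (3 ^ m))) ⟩
      ℓ * (3 * 3 ^ m) / 3 + x / 3     ≡⟨ cong (λ k → k / 3 + x / 3) (lemma ℓ (3 ^ m)) ⟩
      ℓ * 3 ^ m * 3 / 3 + x / 3       ≡⟨ cong (_+ x / 3) (m*n/n≡m (ℓ * 3 ^ m) 3) ⟩
      ℓ * 3 ^ m + x / 3               ∎
      where
      lemma : ∀ ℓ p → ℓ * (3 * p) ≡ ℓ * p * 3
      lemma = solve-∀
  ... | yes n<3 = contradiction n<3 (≤⇒≯ (begin
    3                      ≤⟨ *-monoʳ-≤ 3 (m^n>0 3 m) ⟩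
    3 * 3 ^ m              ≤⟨ 3^≤ d ⟩
    ℓ * (3 * 3 ^ m)        ≤⟨ m≤m+n _ x ⟩
    ℓ * (3 * 3 ^ m) + x    ≡⟨ n≡ ⟨
    n                      ∎))
    where
    open ≤-Reasoning
    3^≤ : ∀ {ℓ p} → Digit⁺ ℓ → p ≤ ℓ * p
    3^≤ {ℓ} {p} one = m≤m+n p _
    3^≤ {ℓ} {p} two = m≤m+n p _

-- Iterated steps with a fixed leading digit.

-- The only possible comma-child of k with leading digit ℓ.
step : ℕ → ℕ → ℕ
step ℓ k = k + (k % 3 * 3 + ℓ)

n≤step : ∀ ℓ n → n ≤ step ℓ n
n≤step ℓ n = m≤m+n n _

step-suc : ∀ ℓ n → step (suc ℓ) n ≡ suc (step ℓ n)
step-suc ℓ n = trans (cong (n +_) (+-suc _ ℓ)) (+-suc n _)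

step-+ : ∀ ℓ {k} n → 3 ∣ k → step ℓ (k + n) ≡ k + step ℓ n
step-+ ℓ {k} n 3∣k =
  trans (cong (λ r → k + n + (r * 3 + ℓ)) (%-remove-+ˡ n 3∣k)) (+-assoc k n _)

-- A step adds `ℓ` modulo 3, and `ℓ` is 1 or 2, so three steps start from each residue once and add
-- `3 * (0 + 1 + 2)` besides `3 * ℓ`.
step³ : ∀ {ℓ} → Digit⁺ ℓ → ∀ n → step ℓ (step ℓ (step ℓ n)) ≡ 9 + 3 * ℓ + n
step³ one 0 = refl
step³ one 1 = refl
step³ one 2 = refl
step³ one (suc (suc (suc n))) = cong (3 +_) (step³ one n)
step³ two 0 = refl
step³ two 1 = refl
step³ two 2 = refl
step³ two (suc (suc (suc n))) = cong (3 +_) (step³ two n)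

walk : ℕ → ℕ → ℕ → ℕ
walk ℓ k n = fold k (step ℓ) n

walk-*3 : ∀ {ℓ} → Digit⁺ ℓ → ∀ k i → walk ℓ k (i * 3) ≡ i * (9 + 3 * ℓ) + k
walk-*3 d k zero = refl
walk-*3 {ℓ} d k (suc i) = begin
  walk ℓ k (suc i * 3)                  ≡⟨ step³ d _ ⟩
  9 + 3 * ℓ + walk ℓ k (i * 3)          ≡⟨ cong (9 + 3 * ℓ +_) (walk-*3 d k i) ⟩
  9 + 3 * ℓ + (i * (9 + 3 * ℓ) + k)     ≡⟨ +-assoc (9 + 3 * ℓ) _ k ⟨
  suc i * (9 + 3 * ℓ) + k               ∎
  where open ≡-Reasoning

-- 60 is the least common multiple of 12 and 15, so one modulus serves both leading digits.
walk-60 : ∀ {ℓ} → Digit⁺ ℓ → ∀ w k → ∃[ i ] walk ℓ k i ≡ w * 60 + k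
walk-60 one w k =
  w * 5 * 3 , trans (walk-*3 one k (w * 5)) (cong (_+ k) (*-assoc w 5 12))
walk-60 two w k =
  w * 4 * 3 , trans (walk-*3 two k (w * 4)) (cong (_+ k) (*-assoc w 4 15))

-- Multiplying by `3 ^ 4` preserves the residue 21, as `81 * 21 = 21 + 28 * 60`. The bound `q ≤ w`
-- will place the block beyond the start of the path.
3^-mod-60 : ∀ q → ∃[ m ] ∃[ w ] 3 ^ suc m ≡ 21 + w * 60 × q ≤ w
3^-mod-60 zero = 3 , 1 , refl , z≤n
3^-mod-60 (suc q) with m , w , eq , q≤w ← 3^-mod-60 q =
  4 + m , 28 + 81 * w ,
  trans (81* (3 ^ suc m)) (trans (cong (81 *_) eq) (mod-60 w)) ,
  s≤s (≤-trans q≤w (≤-trans (m≤n*m w 81) (m≤n+m (81 * w) 27)))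
  where
  81* : ∀ p → 3 * (3 * (3 * (3 * p))) ≡ 81 * p
  81* = solve-∀
  mod-60 : ∀ w → 81 * (21 + w * 60) ≡ 21 + (28 + 81 * w) * 60
  mod-60 = solve-∀

w≤3^ : ∀ m {c w} → 3 ^ m ≡ c + w * 60 → w ≤ 1 * 3 ^ m
w≤3^ m {c} {w} 3^m≡ = begin
  w             ≤⟨ m≤m*n w 60 ⟩
  w * 60        ≤⟨ m≤n+m (w * 60) c ⟩
  c + w * 60    ≡⟨ 3^m≡ ⟨
  3 ^ m         ≡⟨ *-identityˡ (3 ^ m) ⟨
  1 * 3 ^ m     ∎
  where open ≤-Reasoning

-- Nodes visited by a path.

module Path (a : ℕ → ℕ⁺) (successor : ∀ n → CommaSuccessor 3 (a n) (a (suc n))) where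

  Visited : ℕ → Set
  Visited k = ∃[ n ] value (a n) ≡ k

  a-step : ∀ n → ∃[ ℓ ] Digit⁺ ℓ × leadingDigit 3 (value (a (suc n))) ≡ ℓ
                      × value (a (suc n)) ≡ step ℓ (value (a n))
  a-step n = _ , leadingDigit-digit⁺ (proj₂ (a (suc n))) , refl , proj₁ (successor n)

  -- The hypothesis makes `step 1 k` a comma-child; no candidate is smaller, so minimality forces
  -- it.
  step-one : ∀ {k} → leadingDigit 3 (step 1 k) ≡ 1 → Visited k → Visited (step 1 k)
  step-one {k} δ≡1 (n , refl) with ℓ , d , _ , eq ← a-step n =
    suc n , ≤-antisym
      (proj₂ (successor n) (step 1 k , <-≤-trans (proj₂ (a n)) (n≤step 1 k))
             (cong (λ δ → k + (k % 3 * 3 + δ)) (sym δ≡1)))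
      (subst (step 1 k ≤_) (sym eq) (+-monoʳ-≤ k (+-monoʳ-≤ (k % 3 * 3) (1≤ d))))
    where
    1≤ : ∀ {ℓ} → Digit⁺ ℓ → 1 ≤ ℓ
    1≤ one = ≤-refl
    1≤ two = s≤s z≤n

  -- Here `step 1 k` is not a comma-child. As the path continues, `step 2 k` must be one, which
  -- dictates its leading digit.
  step-two : ∀ {k} → leadingDigit 3 (step 1 k) ≡ 2 → Visited k →
             leadingDigit 3 (step 2 k) ≡ 2 × Visited (step 2 k)
  step-two δ≡2 (n , refl) with a-step n
  ... | _ , one , δ≡1 , eq =
    contradiction (trans (sym δ≡2) (trans (cong (leadingDigit 3) (sym eq)) δ≡1)) λ ()
  ... | _ , two , δ≡ , eq = trans (cong (leadingDigit 3) (sym eq)) δ≡ , suc n , eq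

  a-mono : ∀ n → value (a n) < value (a (suc n))
  a-mono n with a-step n
  ... | _ , one , _ , eq = subst (value (a n) <_) (sym eq)
    (subst (value (a n) <_) (sym (step-suc 0 (value (a n)))) (s≤s (n≤step 0 _)))
  ... | _ , two , _ , eq = subst (value (a n) <_) (sym eq)
    (subst (value (a n) <_) (sym (step-suc 1 (value (a n)))) (s≤s (n≤step 1 _)))

  a-gap : ∀ n → value (a (suc n)) ≤ value (a n) + 8
  a-gap n with ℓ , d , _ , eq ← a-step n =
    subst (_≤ value (a n) + 8) (sym eq)
      (+-monoʳ-≤ (value (a n)) (+-mono-≤ (*-monoˡ-≤ 3 (s≤s⁻¹ (m%n<n (value (a n)) 3))) (≤2 d)))
    where
    ≤2 : ∀ {ℓ} → Digit⁺ ℓ → ℓ ≤ 2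
    ≤2 one = s≤s z≤n
    ≤2 two = ≤-refl

  -- Each step advances by at most `2 * 3 + 2 = 8`, so the path cannot jump over eight consecutive
  -- numbers.
  visits-window : ∀ {k} → value (a 0) ≤ k → ∃[ s ] s < 8 × Visited (k + s)
  visits-window a₀≤k = go (≤⇒≤′ a₀≤k)
    where
    go : ∀ {k} → value (a 0) ≤′ k → ∃[ s ] s < 8 × Visited (k + s)
    go (≤′-reflexive refl) = 0 , z<s , 0 , sym (+-identityʳ _)
    go {suc k} (≤′-step a₀≤k) with go a₀≤k
    ... | suc s , s<8 , n , eq = s , <-trans (n<1+n s) s<8 , n , trans eq (+-suc k s)
    ... | zero , _ , n , eq
      with s , eq′ ← m≤n⇒∃[o]m+o≡n (a-mono n) =
      s , +-cancelˡ-< (value (a n)) s 8 (≤-trans (≤-reflexive eq′) (a-gap n)) , suc n ,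
      trans (sym eq′) (cong (λ v → suc (v + s)) (trans eq (+-identityʳ k)))

  -- Crossing a block.

  -- ℓ is the leading digit, and 3 ^ suc m is only remembered modulo 60.
  -- As offsets have to stay below c, the residue 3 is represented by c = 63.
  record At (ℓ c s : ℕ) : Set where
    constructor at
    field
      m w     : ℕ
      power   : 3 ^ suc m ≡ c + w * 60
      visited : Visited (ℓ * 3 ^ suc m + s)

  3∣ : ∀ ℓ m → 3 ∣ ℓ * 3 ^ suc m
  3∣ ℓ m = ∣n⇒∣m*n ℓ (m∣m*n (3 ^ m))

  stay : ∀ {ℓ} → Digit⁺ ℓ → ∀ m {x} → step ℓ x < 3 ^ suc m →
         Visited (ℓ * 3 ^ suc m + x) → Visited (ℓ * 3 ^ suc m + step ℓ x)
  stay one m {x} lt v = subst Visited step≡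
    (step-one (trans (cong (leadingDigit 3) step≡) (leadingDigit-^ (suc m) one lt)) v)
    where
    step≡ : step 1 (1 * 3 ^ suc m + x) ≡ 1 * 3 ^ suc m + step 1 x
    step≡ = step-+ 1 x (3∣ 1 m)
  -- The rival candidate is one smaller and still has leading digit 2, so it is ruled out.
  stay two m {x} lt v = subst Visited (step-+ 2 x (3∣ 2 m))
    (proj₂ (step-two (trans (cong (leadingDigit 3) (step-+ 1 x (3∣ 2 m)))
                            (leadingDigit-^ (suc m) two lt₁)) v))
    where
    lt₁ : step 1 x < 3 ^ suc m
    lt₁ = <-trans (n<1+n _) (subst (_< 3 ^ suc m) (step-suc 1 x) lt)

  -- Offsets never decrease, so bounding the last one bounds them all.
  stay-walk : ∀ {ℓ} → Digit⁺ ℓ → ∀ m {x} n → walk ℓ x n < 3 ^ suc m →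
              Visited (ℓ * 3 ^ suc m + x) → Visited (ℓ * 3 ^ suc m + walk ℓ x n)
  stay-walk d m zero lt v = v
  stay-walk {ℓ} d m {x} (suc n) lt v =
    stay d m lt (stay-walk d m n (≤-<-trans (n≤step ℓ (walk ℓ x n)) lt) v)

  -- y is the offset of the last node of the path below (ℓ + 1) * 3 ^ suc m.
  reach-last : ∀ {ℓ c s t} n → Digit⁺ ℓ → walk ℓ s n < c → walk ℓ s (suc n) ≡ c + t →
    At ℓ c s → ∃[ m ] ∃[ w ] ∃[ y ] 3 ^ suc m ≡ c + w * 60
             × step ℓ y ≡ 3 ^ suc m + t × Visited (ℓ * 3 ^ suc m + y)
  reach-last {ℓ} {c} {s} {t} n d lt eq (at m w M≡ v) =
    m , w , w * 60 + e , M≡ , step-y , visited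
    where
    e = walk ℓ s n
    y< : w * 60 + e < 3 ^ suc m
    y< = begin-strict
      w * 60 + e   <⟨ +-monoʳ-< (w * 60) lt ⟩
      w * 60 + c   ≡⟨ +-comm (w * 60) c ⟩
      c + w * 60   ≡⟨ M≡ ⟨
      3 ^ suc m    ∎
      where open ≤-Reasoning
    step-y : step ℓ (w * 60 + e) ≡ 3 ^ suc m + t
    step-y = begin
      step ℓ (w * 60 + e)   ≡⟨ step-+ ℓ e (∣n⇒∣m*n w (divides 20 refl)) ⟩
      w * 60 + step ℓ e     ≡⟨ cong (w * 60 +_) eq ⟩
      w * 60 + (c + t)      ≡⟨ +-assoc (w * 60) c t ⟨
      w * 60 + c + t        ≡⟨ cong (_+ t) (+-comm (w * 60) c) ⟩
      c + w * 60 + t        ≡⟨ cong (_+ t) M≡ ⟨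
      3 ^ suc m + t         ∎
      where open ≡-Reasoning
    visited : Visited (ℓ * 3 ^ suc m + (w * 60 + e))
    -- First the `n` steps that fit below `c`, then enough steps to advance by `w * 60`.
    visited with i , walk-i ← walk-60 d w e =
      subst (λ y → Visited (ℓ * 3 ^ suc m + y)) walk≡
        (stay-walk d m (i + n) (subst (_< 3 ^ suc m) (sym walk≡) y<) v)
      where
      walk≡ : walk ℓ s (i + n) ≡ w * 60 + e
      walk≡ = trans (fold-+ s (step ℓ) i) walk-i

  <3^ : ∀ {t c w M} → t < c → M ≡ c + w * 60 → t < M
  <3^ t<c M≡ = <-≤-trans t<c (subst (_ ≤_) (sym M≡) (m≤m+n _ _))

  step-at : ∀ ℓ ℓ′ m y {z} → step ℓ′ y ≡ z → step ℓ′ (ℓ * 3 ^ suc m + y) ≡ ℓ * 3 ^ suc m + z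
  step-at ℓ ℓ′ m y eq = trans (step-+ ℓ′ y (3∣ ℓ m)) (cong (ℓ * 3 ^ suc m +_) eq)

  -- Candidate 1 lands at `2 * 3 ^ suc m + t`, where the leading digit is already 2. So the path
  -- takes candidate 2, one further: hence `suc t`.
  to-leading-two : ∀ {c s} n t {_ : True (walk 1 s n <? c)} {_ : True (t <? c)} →
    walk 1 s (suc n) ≡ c + t → At 1 c s → At 2 c (suc t)
  to-leading-two {c} n t {lt} {t<c} eq p
    with m , w , y , M≡ , step-y , v ← reach-last n one (toWitness lt) eq p =
    at m w M≡ (subst Visited
      (trans (step-suc 1 (1 * 3 ^ suc m + y)) (trans (cong suc x≡) (sym (+-suc (2 * 3 ^ suc m) t))))
      (proj₂ (step-two (trans (cong (leadingDigit 3) x≡)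
                              (leadingDigit-^ (suc m) two (<3^ {w = w} (toWitness t<c) M≡))) v)))
    where
    carry : ∀ M t → 1 * M + (M + t) ≡ 2 * M + t
    carry = solve-∀
    x≡ : step 1 (1 * 3 ^ suc m + y) ≡ 2 * 3 ^ suc m + t
    x≡ = trans (step-at 1 1 m y step-y) (carry (3 ^ suc m) t)

  -- Candidate 2 would land at offset `suc t` of the next block, but candidate 1, at offset `t`,
  -- already has leading digit 1 and wins.
  to-next-block : ∀ {c s} n t k c′ {_ : True (walk 2 s n <? c)} {_ : True (t <? c)} →
    walk 2 s (suc n) ≡ c + suc t → 3 * c ≡ c′ + k * 60 → At 2 c s → At 1 c′ t
  to-next-block {c} n t k c′ {lt} {t<c} eq 3c≡ p
    with m , w , y , M≡ , step-y , v ← reach-last n two (toWitness lt) eq p =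
    at (suc m) (k + 3 * w) M′≡ (subst Visited x≡
      (step-one (trans (cong (leadingDigit 3) x≡) (leadingDigit-^ (suc (suc m)) one t<M′)) v))
    where
    carry : ∀ M t → 2 * M + (M + t) ≡ 1 * (3 * M) + t
    carry = solve-∀
    x≡ : step 1 (2 * 3 ^ suc m + y) ≡ 1 * 3 ^ suc (suc m) + t
    x≡ = trans
      (step-at 2 1 m y (suc-injective (trans (sym (step-suc 1 y)) (trans step-y (+-suc _ t)))))
      (carry (3 ^ suc m) t)
    t<M′ : t < 3 ^ suc (suc m)
    t<M′ = <-≤-trans (<3^ {w = w} (toWitness t<c) M≡) (m≤n*m (3 ^ suc m) 3)
    M′≡ : 3 ^ suc (suc m) ≡ c′ + (k + 3 * w) * 60
    M′≡ = begin
      3 * 3 ^ suc m              ≡⟨ cong (3 *_) M≡ ⟩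
      3 * (c + w * 60)           ≡⟨ expand c w ⟩
      3 * c + 3 * w * 60         ≡⟨ cong (_+ 3 * w * 60) 3c≡ ⟩
      c′ + k * 60 + 3 * w * 60   ≡⟨ collect c′ k w ⟩
      c′ + (k + 3 * w) * 60      ∎
      where
      open ≡-Reasoning
      expand : ∀ c w → 3 * (c + w * 60) ≡ 3 * c + 3 * w * 60
      expand = solve-∀
      collect : ∀ c k w → c + k * 60 + 3 * w * 60 ≡ c + (k + 3 * w) * 60
      collect = solve-∀

  -- The last node is 3 ^ (m + 2) - 5: its candidates 3 ^ (m + 2) - 1 and
  -- 3 ^ (m + 2) have leading digits 2 and 1 instead of 1 and 2.
  dead-end : ∀ {c s} n {_ : True (walk 2 s n <? c)} → walk 2 s (suc n) ≡ c + 0 → ¬ At 2 c s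
  dead-end {c} n {lt} eq p
    with m , w , y , M≡ , step-y , v ← reach-last n two (toWitness lt) eq p =
    contradiction (trans (sym δ≡2) δ≡1) λ ()
    where
    below : step 1 y < 3 ^ suc m
    below = ≤-reflexive (trans (sym (step-suc 1 y)) (trans step-y (+-identityʳ _)))
    δ≡2 : leadingDigit 3 (step 2 (2 * 3 ^ suc m + y)) ≡ 2
    δ≡2 = proj₁ (step-two (trans (cong (leadingDigit 3) (step-at 2 1 m y refl))
                                 (leadingDigit-^ (suc m) two below)) v)
    carry : ∀ M → 2 * M + (M + 0) ≡ 1 * (3 * M) + 0
    carry = solve-∀
    δ≡1 : leadingDigit 3 (step 2 (2 * 3 ^ suc m + y)) ≡ 1
    δ≡1 = trans (cong (leadingDigit 3) (trans (step-at 2 2 m y step-y) (carry (3 ^ suc m))))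
                (leadingDigit-^ (suc (suc m)) one (m^n>0 3 (suc (suc m))))

  -- Case analysis, backwards along the cycle of residues.

  ¬At-27-2 : ¬ At 1 27 2
  -- The first argument of each rule counts the steps that stay below `c`; the second is the
  -- overshoot of candidate 1.
  ¬At-27-2 p = dead-end 3 refl (to-leading-two 6 6 refl p)

  ¬At-9-0 : ¬ At 1 9 0
  ¬At-9-0 p = dead-end 0 refl (to-leading-two 2 3 refl p)

  ¬At-9-3 : ¬ At 1 9 3
  ¬At-9-3 p = ¬At-27-2 (to-next-block 0 2 0 27 refl refl (to-leading-two 2 6 refl p))

  ¬At-63-0 : ¬ At 1 63 0
  ¬At-63-0 p = dead-end 11 refl (to-leading-two 16 2 refl p)

  ¬At-63-2 : ¬ At 1 63 2
  ¬At-63-2 p = ¬At-9-3 (to-next-block 11 3 3 9 refl refl (to-leading-two 15 6 refl p))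

  ¬At-63-6 : ¬ At 1 63 6
  ¬At-63-6 p = ¬At-9-0 (to-next-block 11 0 3 9 refl refl (to-leading-two 14 3 refl p))

  -- Apart from offset 2, a dead end, the eight entry offsets merge into 3, 4 and 7 once the leading
  -- digit is 2.
  ¬At-two-21-3 : ¬ At 2 21 3
  ¬At-two-21-3 p = ¬At-63-6 (to-next-block 4 6 0 63 refl refl p)

  ¬At-two-21-4 : ¬ At 2 21 4
  ¬At-two-21-4 p = ¬At-63-2 (to-next-block 3 2 0 63 refl refl p)

  ¬At-two-21-7 : ¬ At 2 21 7
  ¬At-two-21-7 p = ¬At-63-0 (to-next-block 2 0 0 63 refl refl p)

  ¬At-21 : ∀ {s} → s < 8 → ¬ At 1 21 s
  ¬At-21 {0} _ p = ¬At-two-21-4 (to-leading-two 5 3 refl p)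
  ¬At-21 {1} _ p = ¬At-two-21-4 (to-leading-two 4 3 refl p)
  ¬At-21 {2} _ p = dead-end 3 refl (to-leading-two 3 0 refl p)
  ¬At-21 {3} _ p = ¬At-two-21-7 (to-leading-two 5 6 refl p)
  ¬At-21 {4} _ p = ¬At-two-21-7 (to-leading-two 4 6 refl p)
  ¬At-21 {5} _ p = ¬At-two-21-4 (to-leading-two 3 3 refl p)
  ¬At-21 {6} _ p = ¬At-two-21-3 (to-leading-two 4 2 refl p)
  ¬At-21 {7} _ p = ¬At-two-21-3 (to-leading-two 3 2 refl p)
  ¬At-21 {suc (suc (suc (suc (suc (suc (suc (suc s)))))))} s<8 _ =
    contradiction s<8 (m+n≮m 8 s)

  impossible : ⊥
  impossible
    -- The block starts no earlier than the path, so one of its first eight numbers is visited.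
    with m , w , M≡ , a₀≤w ← 3^-mod-60 (value (a 0))
    with s , s<8 , v ← visits-window (≤-trans a₀≤w (w≤3^ (suc m) M≡)) = ¬At-21 s<8 (at m w M≡ v)

theorem9p1 : ¬ InfinitePath (CommaSuccessor 3)
theorem9p1 (a , successor) = Path.impossible a successor
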